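{- Let $\kappa$ be an infinite cardinal and $\mathtt{PROP}$ a set of propositional variables with $|\mathtt{PROP}|\geq\kappa$. If $L_{\kappa\omega}^{\rightarrow}$ is $\kappa$-compact with respect to some $V_{\mathbf S}$ (the class of models corresponding to some system $\mathbf S$ of relevant logic between $\mathbf B$ and $\mathbf{RM}$), then $\kappa$ is a regular limit cardinal (where $\omega$ counts as a regular limit cardinal).
   Context: Language. Given a set $\mathtt{PROP}$ of propositional variables and an infinite cardinal $\kappa$, the formulas of $L_{\kappa\omega}^{\rightarrow}$ are generated by $\phi ::= p \mid \bot \mid {\sim}\phi \mid \bigwedge_{i\in I}\phi_i \mid \bigvee_{i\in I}\phi_i \mid \phi\rightarrow\psi$, with $p\in\mathtt{PROP}$ and $|I|<\kappa$. Models. A (Routley–Meyer) model is $M=\langle W,R,*,T,V\rangle$ with $W$ a non-empty set, $T\in W$, $*:W\to W$ (written $w\mapsto w^*$), $R\subseteq W^3$, and $V:\mathtt{PROP}\to\wp(W)$. A pointed model is a pair $(M,w)$ with $w\in W$. Satisfaction: $M,w\Vdash\bot$ never; $M,w\Vdash p$ iff $w\in V(p)$; $M,w\Vdash{\sim}\phi$ iff $M,w^*\nVdash\phi$; $M,w\Vdash\bigwedge_{i\in I}\phi_i$ iff $M,w\Vdash\phi_i$ for every $i\in I$; $M,w\Vdash\bigvee_{i\in I}\phi_i$ iff $M,w\Vdash\phi_i$ for some $i\in I$; $M,w\Vdash\phi\rightarrow\psi$ iff for all $a,b$ with $Rwab$, if $M,a\Vdash\phi$ then $M,b\Vdash\psi$.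 A $\mathbf B$-model is a model such that for all $x,y,z,v\in W$: $RTxx$; $RTxv$ and $Rvyz$ imply $Rxyz$; $x=x^{**}$; $RTxy$ implies $RTy^*x^*$; and $x\in V(p)$ and $RTxy$ imply $y\in V(p)$ for all $p \in \mathtt{PROP}$. An $\mathbf R$-model is a $\mathbf B$-model such that for all $x,y,z,v$: $Rzxy$ implies $Rzy^*x^*$; if there is $u$ with $Rxyu$ and $Ruzv$, then there is $u$ with $Rxuv$ and $Ryzu$; $Rxxx$; $Rxyz$ implies $Ryxz$. An $\mathbf{RM}$-model is an $\mathbf R$-model such that for all $x,y,z$: $Rxyz$ implies $RTxz$ or $RTyz$. $V_{\mathbf B}$ and $V_{\mathbf{RM}}$ denote the classes of $\mathbf B$-models and $\mathbf{RM}$-models. For a system $\mathbf S$ between $\mathbf B$ and $\mathbf{RM}$, $V_{\mathbf S}$ is the class of all $\mathbf B$-models satisfying certain further first-order conditions on $R,*,T$ (depending on $\mathbf S$), with $V_{\mathbf{RM}}\subseteq V_{\mathbf S}\subseteq V_{\mathbf B}$. A pair $(\Phi,\Psi)$ of sets of formulas has a model in a class $K$ of models if there are $M\in K$ and a world $w$ of $M$ with $M,w\Vdash\phi$ for every $\phi\in\Phi$ and $M,w\nVdash\psi$ for every $\psi\in\Psi$. $L_{\kappa\omega}^{\rightarrow}$ is $\lambda$-compact with respect to $K$ if for every pair $(\Phi,\Psi)$ of sets of formulas of $L_{\kappa\omega}^{\rightarrow}$: whenever every pair $(\Phi_0,\Psi_0)$ with $\Phi_0\subseteq\Phi$, $\Psi_0\subseteq\Psi$,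 $|\Phi_0|,|\Psi_0|<\lambda$ has a model in $K$, then $(\Phi,\Psi)$ has a model in $K$. -}

module Defs where

open import Data.Empty.Polymorphic using (⊥)
open import Data.Fin using (Fin; zero; suc)
open import Data.Nat using (ℕ)
open import Data.Product using (Σ-syntax; ∃-syntax; _×_)
open import Data.Sum using (_⊎_)
open import Function.Bundles using (_↣_; _⇔_)
open import Function.Definitions using (Injective)
open import Induction.WellFounded using (WellFounded)
open import Level using (Level) renaming (suc to lsuc)
open import Relation.Binary.Core using (Rel)
open import Relation.Binary.Definitions using (Irrelevant)
open import Relation.Binary.PropositionalEquality using (_≡_)
open import Relation.Binary.Structures using (IsStrictTotalOrder)
open import Relation.Nullary using (¬_)
open import Relation.Unary using (Pred; _∈_; _⊆_)

private
  variable
    ℓ : Level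

_≺_ : Set ℓ → Set ℓ → Set ℓ
A ≺ B = (A ↣ B) × ¬ (B ↣ A)

-- Cardinals are initial ordinals: well-orders of larger cardinality than
-- each of their proper initial segments.
record Cardinal (ℓ : Level) : Set (lsuc ℓ) where
  infix 4 _<_
  field
    Carrier            : Set ℓ
    _<_                : Rel Carrier ℓ
    isStrictTotalOrder : IsStrictTotalOrder _≡_ _<_
    wellFounded        : WellFounded _<_
    -- Without irrelevance, Segment x could have several copies of one y.
    <-irrelevant       : Irrelevant _<_

  Segment : Carrier → Set ℓ
  Segment x = Σ[ y ∈ Carrier ] y < x

  field
    initial : ∀ x → Segment x ≺ Carrier

∣_∣ : Cardinal ℓ → Set ℓ
∣ κ ∣ = Cardinal.Carrier κ

Infinite : Cardinal ℓ → Set ℓ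
Infinite κ = ℕ ↣ ∣ κ ∣

_IsSuccessorOf_ : Cardinal ℓ → Cardinal ℓ → Set (lsuc ℓ)
κ IsSuccessorOf μ =
  (∣ μ ∣ ≺ ∣ κ ∣) × (∀ ν → ∣ μ ∣ ≺ ∣ ν ∣ → ∣ κ ∣ ↣ ∣ ν ∣)

-- ω counts as a limit cardinal.
IsLimit : Cardinal ℓ → Set (lsuc ℓ)
IsLimit κ = ∣ κ ∣ × ¬ (∃[ μ ] κ IsSuccessorOf μ)

Cofinal : (κ : Cardinal ℓ) {I : Set ℓ} → (I → ∣ κ ∣) → Set ℓ
Cofinal κ f = ∀ x → ∃[ i ] (x < f i ⊎ x ≡ f i)
  where open Cardinal κ

IsRegular : Cardinal ℓ → Set (lsuc ℓ)
IsRegular {ℓ} κ =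
  Infinite κ × (∀ {I : Set ℓ} → I ≺ ∣ κ ∣ → (f : I → ∣ κ ∣) → ¬ Cofinal κ f)

record Model (PROP : Set ℓ) : Set (lsuc ℓ) where
  infix 25 _*
  field
    W  : Set ℓ
    R  : W → W → W → Set ℓ
    _* : W → W
    T  : W
    V  : PROP → Pred W ℓ

record IsBModel {PROP : Set ℓ} (M : Model PROP) : Set ℓ where
  open Model M
  field
    T-refl       : ∀ x → R T x x
    T-comp       : ∀ x y z v → R T x v → R v y z → R x y z
    *-involutive : ∀ x → x ≡ x * *
    *-antitone   : ∀ x y → R T x y → R T (y *) (x *)
    heredity     : ∀ p x y → x ∈ V p → R T x y → y ∈ V p

record IsRModel {PROP : Set ℓ} (M : Model PROP) : Set ℓ where
  open Model M
  field
    isBModel       : IsBModel M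
    contraposition : ∀ x y z → R z x y → R z (y *) (x *)
    suffixing      : ∀ x y z v →
                     (∃[ u ] R x y u × R u z v) → ∃[ u ] R x u v × R y z u
    contraction    : ∀ x → R x x x
    assertion      : ∀ x y z → R x y z → R y x z

record IsRMModel {PROP : Set ℓ} (M : Model PROP) : Set ℓ where
  open Model M
  field
    isRModel : IsRModel M
    mingle   : ∀ x y z → R x y z → R T x z ⊎ R T y z

data Term (n : ℕ) : Set where
  var  : Fin n → Term n
  pt   : Term n
  star : Term n → Term n

infix  6 _≐_
infixr 5 _∧_
infixr 4 _∨_
infixr 3 _⇒_

-- De Bruijn: FO n has free variables in Fin n, the most recent being zero.
data FO (n : ℕ) : Set where
  rel         : Term n → Term n → Term n → FO n
  _≐_         : Term n → Term n → FO n
  falsum      : FO n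
  _∧_ _∨_ _⇒_ : FO n → FO n → FO n
  all ex      : FO (ℕ.suc n) → FO n

Sentence : Set
Sentence = FO 0

module _ {PROP : Set ℓ} (M : Model PROP) where
  private module M = Model M

  Env : ℕ → Set ℓ
  Env n = Fin n → M.W

  _,,_ : ∀ {n} → Env n → M.W → Env (ℕ.suc n)
  (ρ ,, w) zero    = w
  (ρ ,, w) (suc i) = ρ i

  ⟦_⟧ : ∀ {n} → Term n → Env n → M.W
  ⟦ var i ⟧  ρ = ρ i
  ⟦ pt ⟧     ρ = M.T
  ⟦ star t ⟧ ρ = ⟦ t ⟧ ρ M.*

  Holds : ∀ {n} → FO n → Env n → Set ℓ
  Holds (rel s t u) ρ = M.R (⟦ s ⟧ ρ) (⟦ t ⟧ ρ) (⟦ u ⟧ ρ)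
  Holds (s ≐ t)     ρ = ⟦ s ⟧ ρ ≡ ⟦ t ⟧ ρ
  Holds falsum      ρ = ⊥
  Holds (α ∧ β)     ρ = Holds α ρ × Holds β ρ
  Holds (α ∨ β)     ρ = Holds α ρ ⊎ Holds β ρ
  Holds (α ⇒ β)     ρ = Holds α ρ → Holds β ρ
  Holds (all α)     ρ = ∀ w → Holds α (ρ ,, w)
  Holds (ex α)      ρ = ∃[ w ] Holds α (ρ ,, w)

  _⊨_ : Sentence → Set ℓ
  _⊨_ σ = Holds σ (λ ())

V-RM : (PROP : Set ℓ) → Pred (Model PROP) ℓ
V-RM PROP = IsRMModel

V[_] : Pred Sentence ℓ → (PROP : Set ℓ) → Pred (Model PROP) ℓ
V[ Γ ] PROP M = IsBModel M × (∀ σ → σ ∈ Γ → M ⊨ σ)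

-- A system between B and RM enters only through the first-order conditions
-- defining its models; models ⊆ IsBModel holds by construction.
record System (PROP : Set ℓ) : Set (lsuc ℓ) where
  field
    conditions : Pred Sentence ℓ
    RM⊆        : V-RM PROP ⊆ V[ conditions ] PROP

  models : Pred (Model PROP) ℓ
  models = V[ conditions ] PROP

infix  8 ∼_
infixr 6 _⟶_

data Formula (κ : Cardinal ℓ) (PROP : Set ℓ) : Set (lsuc ℓ) where
  prop : PROP → Formula κ PROP
  bot  : Formula κ PROP
  ∼_   : Formula κ PROP → Formula κ PROP
  ⋀ ⋁  : {I : Set ℓ} → I ≺ ∣ κ ∣ → (I → Formula κ PROP) → Formula κ PROP
  _⟶_  : Formula κ PROP → Formula κ PROP → Formula κ PROP

module _ {κ : Cardinal ℓ} {PROP : Set ℓ} where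

  infix 3 _,_⊩_

  _,_⊩_ : (M : Model PROP) → Model.W M → Formula κ PROP → Set ℓ
  M , w ⊩ prop p  = w ∈ Model.V M p
  M , w ⊩ bot     = ⊥
  M , w ⊩ ∼ φ     = ¬ (M , w * ⊩ φ) where open Model M
  M , w ⊩ ⋀ _ φ   = ∀ i → M , w ⊩ φ i
  M , w ⊩ ⋁ _ φ   = ∃[ i ] (M , w ⊩ φ i)
  M , w ⊩ φ ⟶ ψ   = ∀ a b → R w a b → M , a ⊩ φ → M , b ⊩ ψ
    where open Model M

module _ (κ : Cardinal ℓ) (PROP : Set ℓ) where

  FormulaSet : Set (lsuc (lsuc ℓ))
  FormulaSet = Pred (Formula κ PROP) (lsuc ℓ)

module _ {κ : Cardinal ℓ} {PROP : Set ℓ} where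

  -- A set of formulas is a predicate, whose proofs need not be unique, so its
  -- cardinality is that of an injective enumeration, not of Σ[ φ ∈ _ ] φ ∈ Φ.
  SmallerThan : Cardinal ℓ → FormulaSet κ PROP → Set (lsuc ℓ)
  SmallerThan lam Φ =
    Σ[ J ∈ Set ℓ ] (J ≺ ∣ lam ∣) ×
    (Σ[ e ∈ (J → Formula κ PROP) ]
      Injective _≡_ _≡_ e × (∀ φ → φ ∈ Φ ⇔ (∃[ j ] e j ≡ φ)))

  HasModelIn : Pred (Model PROP) ℓ → FormulaSet κ PROP → FormulaSet κ PROP →
               Set (lsuc ℓ)
  HasModelIn K Φ Ψ =
    Σ[ M ∈ Model PROP ] M ∈ K ×
    (Σ[ w ∈ Model.W M ]
      (∀ φ → φ ∈ Φ → M , w ⊩ φ) × (∀ ψ → ψ ∈ Ψ → ¬ (M , w ⊩ ψ)))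

module _ (κ : Cardinal ℓ) (PROP : Set ℓ) where

  Compact : Cardinal ℓ → Pred (Model PROP) ℓ → Set (lsuc (lsuc ℓ))
  Compact lam K =
    ∀ (Φ Ψ : FormulaSet κ PROP) →
    (∀ (Φ₀ Ψ₀ : FormulaSet κ PROP) → Φ₀ ⊆ Φ → Ψ₀ ⊆ Ψ →
       SmallerThan lam Φ₀ → SmallerThan lam Ψ₀ → HasModelIn K Φ₀ Ψ₀) →
    HasModelIn K Φ Ψ

{-# OPTIONS --safe #-}
-- Both halves defeat compactness inside one-world models, which validate every
-- condition of RM and interpret ∼ classically.
--
-- Regularity.  If f : I → κ is cofinal with |I| < κ, then the disjunction of
-- all p_x (x ∈ κ) is equivalent to the formula ⋁_i (p_{f i} ∨ ⋁_{x < f i} p_x).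
-- It is refuted by {p_x : x ∈ κ} but by no smaller set of the p_x.
--
-- Limit.  If κ = μ⁺, then by regularity every set of size < κ injects into μ.
-- For A : μ → 2 let χ_A = ⋀_j ±p_j with signs given by A.  The formula
-- ⋀_j (p_j ∨ ∼p_j) makes some χ_A true at any world of any model, but at most μ
-- of the χ_A can be refuted together with it, by Cantor's diagonal argument.

module Submission where

open import Level using (Level; suc; Lift; lift; lower)
open import Axiom.DoubleNegationElimination using (em⇒dne)
open import Axiom.ExcludedMiddle using (ExcludedMiddle)
open import Data.Bool using (Bool; true; false; if_then_else_)
open import Data.Empty using (⊥-elim)
open import Data.Fin using (toℕ)
open import Data.Fin.Properties using (2↔Bool; toℕ-injective; <⇒notInjective)
open import Data.Nat using (ℕ)
open import Data.Nat.Properties using (n<1+n)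
open import Data.Product using (_×_; _,_; proj₁; proj₂; ∃-syntax; Σ-syntax)
open import Data.Sum using (_⊎_; inj₁; inj₂)
open import Data.Unit.Polymorphic using (⊤; tt)
open import Function.Base using (_∘_; id)
open import Function.Bundles
  using (_↣_; mk↣; module Injection; module Equivalence; module Inverse)
open import Function.Construct.Identity using (↣-id)
open import Function.Properties.Injection using (↣-trans)
open import Function.Properties.Inverse using (↔⇒↣; ↔-sym)
open import Induction.WellFounded using (Acc; acc)
open import Relation.Binary.Definitions using (Trichotomous; tri<; tri≈; tri>)
open import Relation.Binary.PropositionalEquality
  using (_≡_; refl; sym; trans; cong; subst; isEquivalence; resp₂)
open import Relation.Binary.Structures using (IsStrictTotalOrder)
open import Relation.Nullary using (¬_; yes; no)
open import Relation.Nullary.Decidable using (map′)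
open import Relation.Unary using (_∈_; _⊆_)
import Relation.Binary.Construct.On as On
open import Defs

private
  variable
    ℓ : Level

em-lower : ExcludedMiddle (suc ℓ) → ExcludedMiddle ℓ
em-lower {ℓ} em = map′ lower lift (em {Lift (suc ℓ) _})

-- Initial segments and successor cardinals.

module _ (κ : Cardinal ℓ) where
  open Cardinal κ
  private module STO = IsStrictTotalOrder isStrictTotalOrder

  segment-≡ : ∀ {x} {s t : Segment x} → proj₁ s ≡ proj₁ t → s ≡ t
  segment-≡ {s = y , p} {.y , q} refl = cong (y ,_) (<-irrelevant p q)

  segment-mono : ∀ {x y} → x < y → Segment x ↣ Segment y
  segment-mono x<y = mk↣ {to = λ (z , z<x) → z , STO.trans z<x x<y}
                         (segment-≡ ∘ cong proj₁)

  segment-directed : ∀ x y → ∃[ z ] (Segment x ↣ Segment z) × (Segment y ↣ Segment z)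
  segment-directed x y with STO.compare x y
  ... | tri< x<y _ _  = y , segment-mono x<y , ↣-id _
  ... | tri≈ _ refl _ = x , ↣-id _ , ↣-id _
  ... | tri> _ _ y<x  = x , ↣-id _ , segment-mono y<x

  -- The minimality clause of `IsSuccessorOf` ranges over `Cardinal`s, so a segment has to be made
  -- into one before `κ` can be compared with it.
  segmentCardinal : ∀ x → (∀ y → y < x → ¬ (Segment x ↣ Segment y)) → Cardinal ℓ
  segmentCardinal x initial-x = record
    { Carrier            = Segment x
    ; _<_                = _<ₓ_
    ; isStrictTotalOrder = record
        { isStrictPartialOrder = record
            { isEquivalence = isEquivalence
            ; irrefl        = λ { refl → STO.irrefl refl }
            ; trans         = STO.trans
            ; <-resp-≈      = resp₂ _<ₓ_
            }
        ; compare = compare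
        }
    ; wellFounded        = On.wellFounded proj₁ wellFounded
    ; <-irrelevant       = <-irrelevant
    ; initial            = λ (y , y<x) →
        mk↣ {to = proj₁} (λ e → inner-≡ (cong proj₁ e)) ,
        λ g → initial-x y y<x (↣-trans g
          (mk↣ {to = λ ((z , _) , z<y) → z , z<y} (λ e → inner-≡ (cong proj₁ e))))
    }
    where
    _<ₓ_ : Segment x → Segment x → Set ℓ
    s <ₓ t = proj₁ s < proj₁ t

    inner-≡ : ∀ {y} {r s : Σ[ s ∈ Segment x ] proj₁ s < y} →
              proj₁ (proj₁ r) ≡ proj₁ (proj₁ s) → r ≡ s
    inner-≡ {r = (z , p) , p′} {(.z , q) , q′} refl
      with refl ← <-irrelevant p q | refl ← <-irrelevant p′ q′ = refl

    compare : Trichotomous _≡_ _<ₓ_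
    compare s t with STO.compare (proj₁ s) (proj₁ t)
    ... | tri< a b c = tri< a (b ∘ cong proj₁) c
    ... | tri≈ a b c = tri≈ a (segment-≡ b) c
    ... | tri> a b c = tri> a (b ∘ cong proj₁) c

  module _ (em : ExcludedMiddle ℓ) where

    -- Regularity forbids the injection of `J` into `Carrier` to be cofinal, and an `x` that no
    -- value reaches lies strictly above all of them.
    ≺-bounded : IsRegular κ → ∀ {J} → J ≺ Carrier → ∃[ x ] (J ↣ Segment x)
    ≺-bounded (_ , regular) J≺κ@(f , _) = em⇒dne em λ unbounded →
      regular J≺κ to λ x → em⇒dne em λ x-bounds →
        unbounded (x , mk↣ {to = λ i → to i , below x x-bounds i}
                           (injective ∘ cong proj₁))
      where
      open Injection f using (to; injective)
      below : ∀ x → ¬ (∃[ i ] (x < to i ⊎ x ≡ to i)) → ∀ i → to i < x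
      below x x-bounds i with STO.compare x (to i)
      ... | tri< x<fi _ _ = ⊥-elim (x-bounds (i , inj₁ x<fi))
      ... | tri≈ _ x≡fi _ = ⊥-elim (x-bounds (i , inj₂ x≡fi))
      ... | tri> _ _ fi<x = fi<x

    -- Well-founded induction on `x`. Either `Segment x` injects into an earlier segment, which then
    -- also exceeds `μ`, or it is itself a cardinal above `μ`; then `κ` injects into it, against
    -- `initial x`.
    successor-≺-segment : ∀ μ → κ IsSuccessorOf μ → ∀ x → ¬ (∣ μ ∣ ≺ Segment x)
    successor-≺-segment μ (_ , least) x = go x (wellFounded x)
      where
      go : ∀ x → Acc _<_ x → ¬ (∣ μ ∣ ≺ Segment x)
      go x (acc rs) (μ↣x , x↣̸μ) = proj₂ (initial x)
        (least (segmentCardinal x λ y y<x x↣y →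
                  go y (rs y<x) (↣-trans μ↣x x↣y , λ y↣μ → x↣̸μ (↣-trans x↣y y↣μ)))
               (μ↣x , x↣̸μ))

    -- A common segment receives both `J` and `μ`, because refuting `≺` yields an injection back
    -- into `μ` only once `μ` is known to inject into that segment.
    successor-≺⇒↣ : IsRegular κ → ∀ μ → κ IsSuccessorOf μ →
                    ∀ {J} → J ≺ Carrier → J ↣ ∣ μ ∣
    successor-≺⇒↣ regular μ succ@(μ≺κ , _) J≺κ
      with x , J↣x ← ≺-bounded regular J≺κ
         | y , μ↣y ← ≺-bounded regular μ≺κ
      with z , x↣z , y↣z ← segment-directed x y
      = ↣-trans (↣-trans J↣x x↣z) (em⇒dne em λ z↣̸μ →
          successor-≺-segment μ succ z (↣-trans μ↣y y↣z , z↣̸μ))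

-- Opaque, since with-abstraction normalises the formulas that contain it.
abstract
  infinite⇒Bool≺ : ∀ {A : Set ℓ} → ℕ ↣ A → Lift ℓ Bool ≺ A
  infinite⇒Bool≺ ℕ↣A =
    ↣-trans (mk↣ {to = toℕ ∘ B.from ∘ lower}
                  (cong lift ∘ B.from-injective ∘ toℕ-injective)) ℕ↣A ,
    λ A↣Bool → let module H = Injection (↣-trans ℕ↣A A↣Bool) in
      -- Pigeonhole: restricted to three naturals, the composite would be an injection into two
      -- elements.
      <⇒notInjective {f = B.from ∘ lower ∘ H.to ∘ toℕ} (n<1+n 2)
        (toℕ-injective ∘ H.injective ∘ cong lift ∘ B.from-injective)
    where
    module B where
      open Inverse 2↔Bool public using (from)
      from-injective : ∀ {b c} → from b ≡ from c → b ≡ c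
      from-injective = Injection.injective (↔⇒↣ (↔-sym 2↔Bool))

-- One-world models.

module _ {PROP : Set ℓ} (v : PROP → Set ℓ) where

  oneWorld : Model PROP
  oneWorld = record
    { W = ⊤ ; R = λ _ _ _ → ⊤ ; _* = id ; T = tt ; V = λ p _ → v p }

  oneWorld-isRM : IsRMModel oneWorld
  oneWorld-isRM = record
    { isRModel = record
        { isBModel = record
            { T-refl       = λ _ → tt
            ; T-comp       = λ _ _ _ _ _ _ → tt
            ; *-involutive = λ _ → refl
            ; *-antitone   = λ _ _ _ → tt
            ; heredity     = λ _ _ _ p _ → p
            }
        ; contraposition = λ _ _ _ _ → tt
        ; suffixing      = λ _ _ _ _ _ → tt , tt , tt
        ; contraction    = λ _ → tt
        ; assertion      = λ _ _ _ _ → tt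
        }
    ; mingle = λ _ _ _ _ → inj₁ tt
    }

  oneWorld∈ : ∀ (S : System PROP) → oneWorld ∈ System.models S
  oneWorld∈ S = System.RM⊆ S oneWorld-isRM

-- Consequences of compactness.

module _ (em : ExcludedMiddle (suc ℓ)) (κ : Cardinal ℓ) (infinite : Infinite κ)
         {PROP : Set ℓ} (κ↣PROP : ∣ κ ∣ ↣ PROP)
         (S : System PROP) (compact : Compact κ PROP κ (System.models S)) where
  open Cardinal κ
  private
    module P = Injection κ↣PROP

    Fml : Set (suc ℓ)
    Fml = Formula κ PROP

    Bool≺ : Lift ℓ Bool ≺ Carrier
    Bool≺ = infinite⇒Bool≺ infinite

  -- If every variable occurred, sending `x` to an index of its variable would inject `κ` into `J`,
  -- since the index determines the formula.
  ≺-omits-variable : ∀ {Ψ : FormulaSet κ PROP} → SmallerThan κ Ψ →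
                     ∃[ x ] ¬ (prop (P.to x) ∈ Ψ)
  ≺-omits-variable {Ψ} (J , (_ , κ↣̸J) , e , _ , enum) = em⇒dne em λ none-omitted →
    let index : ∀ x → ∃[ j ] e j ≡ prop (P.to x)
        index x = Equivalence.to (enum _) (em⇒dne em λ x∉Ψ → none-omitted (x , x∉Ψ))
    in κ↣̸J (mk↣ {to = proj₁ ∘ index} λ {x} {y} eq →
         P.injective (prop-injective
           (trans (sym (proj₂ (index x))) (trans (cong e eq) (proj₂ (index y))))))
    where
    prop-injective : ∀ {p q} → _≡_ {A = Fml} (prop p) (prop q) → p ≡ q
    prop-injective refl = refl

  ¬cofinal : ∀ {I} → I ≺ Carrier → (f : I → Carrier) → ¬ Cofinal κ f
  ¬cofinal I≺κ f cofinal = no-model (compact Φ Ψ small-model)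
    where
    -- The two cases become a binary disjunction under `⋁ Bool≺`. Splitting off `y` itself leaves a
    -- strict segment, whose size `initial y` bounds.
    var≤ : Carrier → Lift ℓ Bool → Fml
    var≤ y (lift b) = if b then prop (P.to y)
                           else ⋁ (initial y) λ (z , _) → prop (P.to z)

    χ : Fml
    χ = ⋁ I≺κ λ i → ⋁ Bool≺ (var≤ (f i))

    Φ Ψ : FormulaSet κ PROP
    Φ φ = φ ≡ χ
    Ψ ψ = ∃[ x ] ψ ≡ prop (P.to x)

    no-model : ¬ HasModelIn (System.models S) Φ Ψ
    no-model (_ , _ , _ , true-Φ , false-Ψ) with true-Φ χ refl
    ... | i , lift true  , h           = false-Ψ _ (f i , refl) h
    ... | i , lift false , (z , _) , h = false-Ψ _ (z , refl) h

    small-model : ∀ Φ₀ Ψ₀ → Φ₀ ⊆ Φ → Ψ₀ ⊆ Ψ → SmallerThan κ Φ₀ → SmallerThan κ Ψ₀ →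
                  HasModelIn (System.models S) Φ₀ Ψ₀
    small-model Φ₀ Ψ₀ Φ₀⊆Φ Ψ₀⊆Ψ _ Ψ₀<κ with x , x∉Ψ₀ ← ≺-omits-variable Ψ₀<κ =
      oneWorld v , oneWorld∈ v S , tt , true-Φ₀ , false-Ψ₀
      where
      -- One true variable suffices for `χ`; the one at `x` is safe, being absent from `Ψ₀`.
      v : PROP → Set ℓ
      v p = p ≡ P.to x

      true-χ : oneWorld v , tt ⊩ χ
      true-χ with cofinal x
      ... | i , inj₁ x<fi = i , lift false , (x , x<fi) , refl
      ... | i , inj₂ x≡fi = i , lift true , cong P.to (sym x≡fi)

      true-Φ₀ : ∀ φ → φ ∈ Φ₀ → oneWorld v , tt ⊩ φ
      true-Φ₀ φ φ∈Φ₀ with refl ← Φ₀⊆Φ φ∈Φ₀ = true-χ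

      false-Ψ₀ : ∀ ψ → ψ ∈ Ψ₀ → ¬ (oneWorld v , tt ⊩ ψ)
      false-Ψ₀ ψ ψ∈Ψ₀ h with y , refl ← Ψ₀⊆Ψ ψ∈Ψ₀ =
        x∉Ψ₀ (subst (λ p → prop p ∈ Ψ₀) h ψ∈Ψ₀)

  -- Used with `A` the carrier of `μ` when `κ` is its successor. The injection of `J` into `A` gives
  -- each refuted formula its own coordinate on which to diagonalise.
  ≺-uncovered : ∀ {A} → A ≺ Carrier → ¬ (∀ {J} → J ≺ Carrier → J ↣ A)
  ≺-uncovered {A} A≺κ cover = no-model (compact Φ Ψ small-model)
    where
    module Q = Injection (↣-trans (proj₁ A≺κ) κ↣PROP)

    literal : Lift ℓ Bool → A → Fml
    literal (lift b) a = if b then prop (Q.to a) else ∼ prop (Q.to a)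

    χ : (A → Lift ℓ Bool) → Fml
    χ signs = ⋀ A≺κ λ a → literal (signs a) a

    decided : Fml
    decided = ⋀ A≺κ λ a → ⋁ Bool≺ λ b → literal b a

    Φ Ψ : FormulaSet κ PROP
    Φ φ = φ ≡ decided
    Ψ ψ = ∃[ signs ] ψ ≡ χ signs

    no-model : ¬ HasModelIn (System.models S) Φ Ψ
    no-model (_ , _ , _ , true-Φ , false-Ψ) =
      -- The true disjunct at each coordinate supplies a sign, and these signs define a `χ` true at
      -- the world.
      false-Ψ _ (proj₁ ∘ choice , refl) (proj₂ ∘ choice)
      where choice = true-Φ decided refl

    small-model : ∀ Φ₀ Ψ₀ → Φ₀ ⊆ Φ → Ψ₀ ⊆ Ψ → SmallerThan κ Φ₀ → SmallerThan κ Ψ₀ →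
                  HasModelIn (System.models S) Φ₀ Ψ₀
    small-model Φ₀ Ψ₀ Φ₀⊆Φ Ψ₀⊆Ψ _ (J , J≺κ , e , _ , enum) =
      oneWorld v , oneWorld∈ v S , tt , true-Φ₀ , false-Ψ₀
      where
      module H = Injection (cover J≺κ)

      e∈Ψ : ∀ j → e j ∈ Ψ
      e∈Ψ j = Ψ₀⊆Ψ (Equivalence.from (enum (e j)) (j , refl))

      diagonal : J → Bool
      diagonal j = lower (proj₁ (e∈Ψ j) (H.to j))

      -- At its own coordinate `H.to j` the valuation contradicts the sign prescribed by the `j`-th
      -- formula.
      v : PROP → Set ℓ
      v p = ∃[ j ] Q.to (H.to j) ≡ p × diagonal j ≡ false

      true-decided : oneWorld v , tt ⊩ decided
      true-decided a with em-lower em {v (Q.to a)}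
      ... | yes va = lift true  , va
      ... | no ¬va = lift false , ¬va

      true-Φ₀ : ∀ φ → φ ∈ Φ₀ → oneWorld v , tt ⊩ φ
      true-Φ₀ φ φ∈Φ₀ with refl ← Φ₀⊆Φ φ∈Φ₀ = true-decided

      diagonal-fails : ∀ j → ¬ (oneWorld v , tt ⊩ literal (lift (diagonal j)) (H.to j))
      diagonal-fails j h with diagonal j in eq
      ... | false = h (j , refl , eq)
      -- The variable at `H.to j` is made true by some `i` with a negative sign; injectivity makes
      -- it `j`, whose sign is positive.
      ... | true with i , i≡j , eq′ ← h
                 with refl ← H.injective (Q.injective i≡j)
                 with () ← trans (sym eq) eq′

      false-Ψ₀ : ∀ ψ → ψ ∈ Ψ₀ → ¬ (oneWorld v , tt ⊩ ψ)
      false-Ψ₀ ψ ψ∈Ψ₀ h with j , refl ← Equivalence.to (enum ψ) ψ∈Ψ₀ =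
        diagonal-fails j
          (subst (oneWorld v , tt ⊩_) (proj₂ (e∈Ψ j)) h (H.to j))

proposition3 : ∀ {ℓ : Level} → ExcludedMiddle (suc ℓ) →
    (κ : Cardinal ℓ) → Infinite κ →
    (PROP : Set ℓ) → (∣ κ ∣ ↣ PROP) →
    (∃[ S ] Compact κ PROP κ (System.models {PROP = PROP} S)) →
    IsRegular κ × IsLimit κ
proposition3 em κ infinite PROP κ↣PROP (S , compact) =
  regular , Injection.to infinite 0 ,
  λ (μ , succ) → ≺-uncovered em κ infinite κ↣PROP S compact (proj₁ succ)
                   (successor-≺⇒↣ κ (em-lower em) regular μ succ)
  where
  regular : IsRegular κ
  regular = infinite , ¬cofinal em κ infinite κ↣PROP S compact
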